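{- For every $n\ge 1$, the complete graph $K_n$ is a minimal element in the poset $\mathcal{E}_n$.
   Context: All graphs are finite and simple. The chromatic symmetric function of a graph $G$ with vertices $v_1,\dots,v_n$ is $X_G=\sum_{\kappa}x_{\kappa(v_1)}\cdots x_{\kappa(v_n)}$, summed over all proper colorings $\kappa:V(G)\to\{1,2,3,\dots\}$; it is a homogeneous symmetric function of degree $n$ over $\mathbb{Q}$. Let $e_\lambda=e_{\lambda_1}e_{\lambda_2}\cdots$ be the elementary symmetric functions; $[e_\lambda]F$ denotes the coefficient of $e_\lambda$ in $F$ expanded in this basis, and $F$ is $e$-positive if $[e_\lambda]F\ge 0$ for all $\lambda$. For connected graphs $G,H$ on $n$ vertices (for which $[e_{(n)}]X_G$ and $[e_{(n)}]X_H$ are positive), set $$X_e(G,H)=X_G-\frac{[e_{(n)}]X_G}{[e_{(n)}]X_H}X_H.$$ $\mathcal{E}_n$ is the poset whose elements are the equivalence classes of connected graphs on $n$ vertices under $G\sim H\iff X_G=X_H$, ordered by $G\geq_e H$ if and only if $X_e(G,H)$ is $e$-positive. An element $x$ of a poset is minimal if $y\geq x$ for every $y$ comparable to $x$. -}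

module Defs where

open import Data.Bool.Base using (if_then_else_)
open import Data.Fin.Base using (Fin)
import Data.Fin.Properties as Fin
open import Data.Integer.Base using (+_)
open import Data.List.Base
  using (List; []; _∷_; _++_; map; foldr; filter; length; lookup; upTo; allFin; cartesianProductWith)
open import Data.List.Membership.Propositional using (_∈_)
open import Data.List.Relation.Unary.All as All using (All)
open import Data.List.Relation.Unary.Linked as Linked using (Linked)
open import Data.Nat.Base as ℕ using (ℕ; zero; suc)
open import Data.Nat.ListAction using (sum)
import Data.Nat.Properties as ℕ
open import Data.Product.Base using (Σ; _×_; _,_)
open import Data.Rational.Base
  using (ℚ; 0ℚ; _+_; _-_; _*_; _÷_; _/_; _≤_; NonZero)
open import Data.Sum.Base using (_⊎_)
open import Data.Vec.Base as Vec using (Vec; []; _∷_)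
open import Function.Base using (flip)
open import Level using (0ℓ) renaming (suc to lsuc)
open import Relation.Binary.Bundles.Raw using (RawRelation)
open import Relation.Binary.Construct.Closure.ReflexiveTransitive using (Star; ε; _◅_)
open import Relation.Binary.Core using (Rel)
open import Relation.Binary.Definitions using (Decidable; Irreflexive; Symmetric)
open import Relation.Binary.PropositionalEquality
  using (_≡_; _≢_; refl; sym)
open import Relation.Nullary.Decidable using (yes; no; does; ¬?; _×-dec_; _→-dec_)
open import Relation.Unary using () renaming (Decidable to Decidable₁)

------------------------------------------------------------------------
-- Graphs

record Graph (n : ℕ) : Set₁ where
  field
    _~_    : Rel (Fin n) 0ℓ
    _~?_   : Decidable _~_
    ~-sym  : Symmetric _~_
    ~-irrefl : Irreflexive _≡_ _~_

Connected : ∀ {n} → Graph n → Set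
Connected G = ∀ u v → Star (Graph._~_ G) u v

record ConnectedGraph (n : ℕ) : Set₁ where
  field
    graph     : Graph n
    connected : Connected graph

complete : ∀ n → Graph n
complete n = record
  { _~_      = _≢_
  ; _~?_     = λ u v → ¬? (u Fin.≟ v)
  ; ~-sym    = λ u≢v v≡u → u≢v (sym v≡u)
  ; ~-irrefl = λ u≡v u≢v → u≢v u≡v
  }

K : ∀ n → ConnectedGraph n
K n = record { graph = complete n ; connected = conn }
  where
  conn : Connected (complete n)
  conn u v with u Fin.≟ v
  ... | yes refl = ε
  ... | no u≢v   = u≢v ◅ ε

------------------------------------------------------------------------
-- Formal power series over ℚ in x₁, x₂, …

-- The list α₁ ∷ … ∷ αₖ ∷ [] stands for the monomial x₁^α₁ ⋯ xₖ^αₖ, and a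
-- series is given by its coefficients.  Lists differing by trailing zeros
-- name the same monomial; all the series used below agree on such lists.
Monomial : Set
Monomial = List ℕ

Series : Set
Series = Monomial → ℚ

infix 4 _≐_
_≐_ : Rel Series 0ℓ
F ≐ F′ = ∀ α → F α ≡ F′ α

infixl 6 _⊖_
_⊖_ : Series → Series → Series
(F ⊖ F′) α = F α - F′ α

infixr 7 _·_
_·_ : ℚ → Series → Series
(q · F) α = q * F α

Σℚ : ∀ {A : Set} → List A → (A → ℚ) → ℚ
Σℚ xs f = foldr _+_ 0ℚ (map f xs)

-- All pairs (β , γ) with xᵅ = xᵝ xᵞ.
factorizations : Monomial → List (Monomial × Monomial)
factorizations []      = ([] , []) ∷ []
factorizations (a ∷ α) =
  cartesianProductWith (λ b (β , γ) → (b ∷ β) , (a ℕ.∸ b ∷ γ))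
    (upTo (suc a)) (factorizations α)

infixl 7 _⊛_
_⊛_ : Series → Series → Series
(F ⊛ F′) α = Σℚ (factorizations α) λ (β , γ) → F β * F′ γ

------------------------------------------------------------------------
-- Elementary symmetric functions

-- e k is the sum of all squarefree monomials of degree k; in particular
-- e 0 is the series 1.
e : ℕ → Series
e k α = if does (All.all? (ℕ._≤? 1) α ×-dec (sum α ℕ.≟ k)) then + 1 / 1 else 0ℚ

eProd : List ℕ → Series
eProd l = foldr (λ k F → e k ⊛ F) (e 0) l

bump : List ℕ → List ℕ
bump []      = []
bump (a ∷ l) = suc a ∷ l

-- Each composition of n + 2 arises from one of n + 1 by prepending a part 1
-- or by increasing the first part.
compositions : ℕ → List (List ℕ)
compositions zero          = [] ∷ []
compositions (suc zero)    = (1 ∷ []) ∷ []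
compositions (suc (suc n)) =
  map (1 ∷_) (compositions (suc n)) ++ map bump (compositions (suc n))

partitions : ℕ → List (List ℕ)
partitions n = filter (Linked.linked? ℕ._≥?_) (compositions n)

-- The expansion of a series, homogeneous of degree n, in the basis
-- (e_λ), λ ⊢ n.  The series having one are exactly the symmetric functions
-- of degree n, and for λ ∈ partitions n the number coeff λ = [e_λ] F is then
-- determined by F.  Values of coeff elsewhere are irrelevant.
record EExpansion (n : ℕ) (F : Series) : Set where
  field
    coeff   : List ℕ → ℚ
    expands : F ≐ λ α → Σℚ (partitions n) λ l → coeff l * eProd l α

[e_] : List ℕ → ∀ {n F} → EExpansion n F → ℚ
[e l ] E = EExpansion.coeff E l

EPositive : ℕ → Series → Set
EPositive n F = Σ (EExpansion n F) λ E → ∀ {l} → l ∈ partitions n → 0ℚ ≤ [e l ] E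

------------------------------------------------------------------------
-- The chromatic symmetric function

-- All maps Fin n → Fin k, as vectors of values.
colorings : ∀ n k → List (Vec (Fin k) n)
colorings zero    k = [] ∷ []
colorings (suc n) k = cartesianProductWith _∷_ (allFin k) (colorings n k)

module _ {n : ℕ} (G : Graph n) where
  open Graph G

  Proper : ∀ {k} → Vec (Fin k) n → Set
  Proper κ = ∀ u v → u ~ v → Vec.lookup κ u ≢ Vec.lookup κ v

  proper? : ∀ {k} → Decidable₁ (Proper {k})
  proper? κ = Fin.all? λ u → Fin.all? λ v →
    (u ~? v) →-dec ¬? (Vec.lookup κ u Fin.≟ Vec.lookup κ v)

-- x_{κ(v₁)} ⋯ x_{κ(vₙ)} = xᵅ
HasContent : ∀ {n} (α : Monomial) → Vec (Fin (length α)) n → Set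
HasContent α κ = ∀ i → Vec.count (i Fin.≟_) κ ≡ lookup α i

hasContent? : ∀ {n} α → Decidable₁ (HasContent {n} α)
hasContent? α κ = Fin.all? λ i → Vec.count (i Fin.≟_) κ ℕ.≟ lookup α i

-- The coefficient of xᵅ is the number of proper colorings κ whose monomial
-- is xᵅ; such κ only use the colors 1, …, length α.
X : ∀ {n} → Graph n → Series
X {n} G α = + length (filter (λ κ → proper? G κ ×-dec hasContent? α κ)
                             (colorings n (length α))) / 1

------------------------------------------------------------------------
-- The poset 𝓔ₙ

module _ {n : ℕ} where
  open ConnectedGraph

  Xᴱ : ConnectedGraph n → Series
  Xᴱ G = X (graph G)

  Xₑ : (G H : ConnectedGraph n) (EG : EExpansion n (Xᴱ G)) (EH : EExpansion n (Xᴱ H)) →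
       .{{NonZero ([e n ∷ [] ] EH)}} → Series
  Xₑ G H EG EH = Xᴱ G ⊖ ([e n ∷ [] ] EG ÷ [e n ∷ [] ] EH) · Xᴱ H

  -- Since [e_(n)] is uniquely determined and positive on chromatic symmetric
  -- functions of connected graphs, the first three fields only supply the
  -- data which X_e (G , H) is made of.
  infix 4 _≥ₑ_
  record _≥ₑ_ (G H : ConnectedGraph n) : Set where
    field
      expansionˡ : EExpansion n (Xᴱ G)
      expansionʳ : EExpansion n (Xᴱ H)
      {{nonZero}} : NonZero ([e n ∷ [] ] expansionʳ)
      ePositive  : EPositive n (Xₑ G H expansionˡ expansionʳ)

-- Equivalence classes are represented by graphs, with X_G = X_H as the
-- equality; the relation _∼_ of the bundle is ≤.
𝓔 : ℕ → RawRelation (lsuc 0ℓ) 0ℓ 0ℓ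
𝓔 n = record
  { Carrier = ConnectedGraph n
  ; _≈_     = λ G H → Xᴱ G ≐ Xᴱ H
  ; _∼_     = flip _≥ₑ_
  }

module _ {c ℓ₁ ℓ₂} (P : RawRelation c ℓ₁ ℓ₂) where
  open RawRelation P renaming (_∼_ to _≤ᴾ_; _∼ᵒ_ to _≥ᴾ_)

  IsMinimal : Carrier → Set _
  IsMinimal x = ∀ y → (y ≥ᴾ x) ⊎ (x ≥ᴾ y) → y ≥ᴾ x

{-# OPTIONS --safe #-}

-- The coefficient of e_μ at x^λ′, λ′ the conjugate of λ, is positive for
-- μ = λ and zero for μ lexicographically greater than λ.  By triangularity
-- [e_(n)] is well defined, and since X_Kₙ vanishes at x^λ′ for λ ≠ (n),
-- X_Kₙ is a nonzero multiple of e_(n).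
-- If Kₙ ≥ H, then P = X_e(Kₙ, H) has nonnegative coefficients p_λ with
-- p_(n) = 0, and X_e(H, Kₙ) = − q P with q = [e_(n)]X_H / [e_(n)]X_Kₙ.
-- So we are done if q ≤ 0.  If q ≥ 0, the coefficient of q P at x^λ′ is at
-- least q p_λ times a positive number, while it equals that of − X_H, which
-- is at most 0; hence q p_λ ≤ 0.
module Submission where

open import Defs
import Algebra.Properties.Group as GroupProperties
open import Data.Bool.Base using (if_then_else_)
open import Data.Fin.Base using (Fin; zero; suc)
import Data.Fin.Properties as Fin
import Data.Integer.Base as ℤ
open import Data.List.Base
  using (List; []; _∷_; _++_; _∷ʳ_; map; filter; length; drop; replicate; allFin; upTo)
open import Data.List.Membership.Propositional using (_∈_)
open import Data.List.Membership.Propositional.Properties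
  using (∈-cartesianProductWith⁺; ∈-cartesianProductWith⁻; ∈-upTo⁺; ∈-upTo⁻; ∈-allFin;
         ∈-filter⁺; ∈-++⁺ˡ; ∈-++⁻; ∈-lookup)
import Data.List.Properties as List
open import Data.List.Relation.Unary.All as All using (All; []; _∷_)
import Data.List.Relation.Unary.All.Properties as All
open import Data.List.Relation.Unary.AllPairs as AllPairs using (AllPairs; []; _∷_)
import Data.List.Relation.Unary.AllPairs.Properties as AllPairs
open import Data.List.Relation.Unary.Any using (here; there)
open import Data.List.Relation.Unary.Linked using (linked?)
open import Data.List.Relation.Unary.Linked.Properties using (Linked⇒AllPairs)
open import Data.Nat.Base as ℕ using (ℕ; zero; suc; z≤n; s≤s; _≤_; _<_; _≥_)
open import Data.Nat.ListAction using (sum)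
import Data.Nat.Properties as ℕ
open import Data.Product.Base using (∃; ∃₂; _×_; _,_; proj₁; proj₂)
open import Data.Rational.Base as ℚ
  using (ℚ; 0ℚ; 1ℚ; _+_; _-_; _*_; -_; _÷_; 1/_; _/_; NonZero)
import Data.Rational.Properties as ℚ
open import Data.Rational.Solver using (module +-*-Solver)
open import Data.Sum.Base using (_⊎_; inj₁; inj₂; [_,_]′)
open import Data.Vec.Base as Vec using (Vec; []; _∷_)
import Data.Vec.Properties as Vec
open import Function.Base using (_∘_)
open import Relation.Binary.PropositionalEquality
  using (_≡_; _≢_; _≗_; refl; sym; trans; cong; cong₂; subst; ≢-sym; module ≡-Reasoning)
open import Relation.Nullary using (¬_; Dec; yes; no; does; contradiction)
open import Relation.Nullary.Decidable using (_×-dec_; dec-true; decidable-stable)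
open import Relation.Unary using (Decidable)

private variable
  A : Set
  n : ℕ

-- Finite sums

Σℚ-zero : (xs : List A) {f : A → ℚ} → (∀ {x} → x ∈ xs → f x ≡ 0ℚ) → Σℚ xs f ≡ 0ℚ
Σℚ-zero []       f≡0 = refl
Σℚ-zero (x ∷ xs) f≡0 = cong₂ _+_ (f≡0 (here refl)) (Σℚ-zero xs (f≡0 ∘ there))

Σℚ-cong : (xs : List A) {f g : A → ℚ} → f ≗ g → Σℚ xs f ≡ Σℚ xs g
Σℚ-cong []       f≗g = refl
Σℚ-cong (x ∷ xs) f≗g = cong₂ _+_ (f≗g x) (Σℚ-cong xs f≗g)

Σℚ-distrib-- : (xs : List A) (f g : A → ℚ) → Σℚ xs (λ x → f x - g x) ≡ Σℚ xs f - Σℚ xs g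
Σℚ-distrib-- []       f g = refl
Σℚ-distrib-- (x ∷ xs) f g rewrite Σℚ-distrib-- xs f g =
  solve 4 (λ a b c d → (a :- b) :+ (c :- d) := (a :+ c) :- (b :+ d)) refl
    (f x) (g x) (Σℚ xs f) (Σℚ xs g)
  where open +-*-Solver

*-distribˡ-Σℚ : (q : ℚ) (xs : List A) (f : A → ℚ) → q * Σℚ xs f ≡ Σℚ xs (λ x → q * f x)
*-distribˡ-Σℚ q []       f = ℚ.*-zeroʳ q
*-distribˡ-Σℚ q (x ∷ xs) f =
  trans (ℚ.*-distribˡ-+ q (f x) (Σℚ xs f)) (cong (q * f x +_) (*-distribˡ-Σℚ q xs f))

Σℚ-nonNeg : (xs : List A) {f : A → ℚ} → (∀ {x} → x ∈ xs → 0ℚ ℚ.≤ f x) → 0ℚ ℚ.≤ Σℚ xs f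
Σℚ-nonNeg []       f≥0 = ℚ.≤-refl
Σℚ-nonNeg (x ∷ xs) f≥0 = ℚ.+-mono-≤ (f≥0 (here refl)) (Σℚ-nonNeg xs (f≥0 ∘ there))

term≤Σℚ : (xs : List A) {f : A → ℚ} → (∀ {x} → x ∈ xs → 0ℚ ℚ.≤ f x) →
          ∀ {x} → x ∈ xs → f x ℚ.≤ Σℚ xs f
term≤Σℚ (x ∷ xs) {f} f≥0 (here refl) =
  subst (ℚ._≤ Σℚ (x ∷ xs) f) (ℚ.+-identityʳ (f x))
    (ℚ.+-monoʳ-≤ (f x) (Σℚ-nonNeg xs (f≥0 ∘ there)))
term≤Σℚ (x ∷ xs) {f} f≥0 {y} (there y∈xs) =
  subst (ℚ._≤ Σℚ (x ∷ xs) f) (ℚ.+-identityˡ (f y))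
    (ℚ.+-mono-≤ (f≥0 (here refl)) (term≤Σℚ xs (f≥0 ∘ there) y∈xs))

*-nonNeg : ∀ {p q} → 0ℚ ℚ.≤ p → 0ℚ ℚ.≤ q → 0ℚ ℚ.≤ p * q
*-nonNeg {p} {q} p≥0 q≥0 = ℚ.nonNegative⁻¹ (p * q)
  {{ℚ.nonNeg*nonNeg⇒nonNeg p {{ℚ.nonNegative p≥0}} q {{ℚ.nonNegative q≥0}}}}

-- Expansions in the e-basis

infixl 6 _⊖ᴱ_
_⊖ᴱ_ : ∀ {F F′} → EExpansion n F → EExpansion n F′ → EExpansion n (F ⊖ F′)
_⊖ᴱ_ {n} {F} {F′} E E′ = record
  { coeff   = λ l → [e l ] E - [e l ] E′
  ; expands = λ α → begin
      F α - F′ α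
        ≡⟨ cong₂ _-_ (EExpansion.expands E α) (EExpansion.expands E′ α) ⟩
      Σℚ ps (λ l → [e l ] E * eProd l α) - Σℚ ps (λ l → [e l ] E′ * eProd l α)
        ≡⟨ Σℚ-distrib-- ps _ _ ⟨
      Σℚ ps (λ l → [e l ] E * eProd l α - [e l ] E′ * eProd l α)
        ≡⟨ Σℚ-cong ps (λ l → solve 3 (λ a b c → a :* c :- b :* c := (a :- b) :* c) refl
             ([e l ] E) ([e l ] E′) (eProd l α)) ⟩
      Σℚ ps (λ l → ([e l ] E - [e l ] E′) * eProd l α) ∎
  }
  where
  open ≡-Reasoning
  open +-*-Solver
  ps = partitions n

infixr 7 _·ᴱ_
_·ᴱ_ : ∀ {F} (q : ℚ) → EExpansion n F → EExpansion n (q · F)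
_·ᴱ_ {n} q E = record
  { coeff   = λ l → q * [e l ] E
  ; expands = λ α →
      trans (cong (q *_) (EExpansion.expands E α))
     (trans (*-distribˡ-Σℚ q (partitions n) _)
            (Σℚ-cong (partitions n) λ l → sym (ℚ.*-assoc q ([e l ] E) (eProd l α))))
  }

EExpansion-resp-≐ : ∀ {F F′} → F ≐ F′ → EExpansion n F → EExpansion n F′
EExpansion-resp-≐ F≐F′ E = record
  { coeff   = EExpansion.coeff E
  ; expands = λ α → trans (sym (F≐F′ α)) (EExpansion.expands E α)
  }

-- Compositions in lexicographic order

infix 4 _≺_
-- A list is unrelated to its proper extensions. Among compositions of one number this case never
-- arises, since a proper extension has a larger sum.
data _≺_ : List ℕ → List ℕ → Set where
  this : ∀ {a b l m} → a < b → a ∷ l ≺ b ∷ m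
  next : ∀ {a l m} → l ≺ m → a ∷ l ≺ a ∷ m

IsComposition : ℕ → List ℕ → Set
IsComposition n l = All (1 ≤_) l × sum l ≡ n

compositions-sound : ∀ n → All (IsComposition n) (compositions n)
compositions-sound zero          = ([] , refl) ∷ []
compositions-sound (suc zero)    = (s≤s z≤n ∷ [] , refl) ∷ []
compositions-sound (suc (suc n)) = let ih = compositions-sound (suc n) in All.++⁺
  (All.map⁺ (All.map (λ (pos , eq) → s≤s z≤n ∷ pos , cong suc eq) ih))
  (All.map⁺ (All.map (λ { {_ ∷ _} (_ ∷ pos , eq) → s≤s z≤n ∷ pos , cong suc eq }) ih))

bump-mono-≺ : ∀ {l m} → l ≺ m → bump l ≺ bump m
bump-mono-≺ (this a<b) = this (s≤s a<b)
bump-mono-≺ (next l≺m) = next l≺m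

-- Both `1 ∷_` and `bump` preserve the order, and the recursion puts the block with first part 1
-- before the block with first part at least 2.
compositions-sorted : ∀ n → AllPairs _≺_ (compositions n)
compositions-sorted zero          = [] ∷ []
compositions-sorted (suc zero)    = [] ∷ []
compositions-sorted (suc (suc n)) = let ih = compositions-sorted (suc n) in AllPairs.++⁺
  (AllPairs.map⁺ (AllPairs.map next ih))
  (AllPairs.map⁺ (AllPairs.map bump-mono-≺ ih))
  (All.map⁺ (All.universal (λ _ → All.map⁺ (All.map 1∷≺bump (compositions-sound (suc n)))) _))
  where
  1∷≺bump : ∀ {l m} → IsComposition (suc n) m → 1 ∷ l ≺ bump m
  1∷≺bump {m = _ ∷ _} (1≤a ∷ _ , _) = this (s≤s 1≤a)

compositions-last : ∀ n → ∃ λ cs → compositions (suc n) ≡ cs ∷ʳ (suc n ∷ [])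
compositions-last zero    = [] , refl
compositions-last (suc n) =
  let cs , eq = compositions-last n in
  map (1 ∷_) (compositions (suc n)) ++ map bump cs ,
  (begin
    map (1 ∷_) (compositions (suc n)) ++ map bump (compositions (suc n))
      ≡⟨ cong (λ ds → map (1 ∷_) (compositions (suc n)) ++ map bump ds) eq ⟩
    map (1 ∷_) (compositions (suc n)) ++ map bump (cs ∷ʳ (suc n ∷ []))
      ≡⟨ cong (map (1 ∷_) (compositions (suc n)) ++_) (List.map-++ bump cs _) ⟩
    map (1 ∷_) (compositions (suc n)) ++ (map bump cs ∷ʳ (suc (suc n) ∷ []))
      ≡⟨ List.++-assoc (map (1 ∷_) (compositions (suc n))) (map bump cs) _ ⟨
    (map (1 ∷_) (compositions (suc n)) ++ map bump cs) ∷ʳ (suc (suc n) ∷ []) ∎)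
  where open ≡-Reasoning

partitions-last : ∀ n → ∃ λ ps → partitions (suc n) ≡ ps ∷ʳ (suc n ∷ [])
partitions-last n =
  let cs , eq = compositions-last n in
  filter (linked? ℕ._≥?_) cs ,
  -- `linked?` accepts a one-part list by computation, so the last composition survives the filter.
  trans (cong (filter (linked? ℕ._≥?_)) eq) (List.filter-++ (linked? ℕ._≥?_) cs _)

partitions-ordered : ∀ n → AllPairs _≺_ (partitions n)
partitions-ordered n = AllPairs.filter⁺ (linked? ℕ._≥?_) (compositions-sorted n)

partitions-composition : ∀ n → All (IsComposition n) (partitions n)
partitions-composition n = All.filter⁺ (linked? ℕ._≥?_) (compositions-sound n)

partitions-decreasing : ∀ n → All (AllPairs _≥_) (partitions n)
partitions-decreasing n =
  All.map (Linked⇒AllPairs (λ a≥b b≥c → ℕ.≤-trans b≥c a≥b))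
    (All.all-filter (linked? ℕ._≥?_) (compositions n))

-- Values of e-products at conjugate partitions

-- Multiplication by x₁ ⋯ xₐ, truncated to the variables that the list displays.
raise : ℕ → Monomial → Monomial
raise zero    α       = α
raise (suc a) []      = []
raise (suc a) (x ∷ α) = suc x ∷ raise a α

-- The conjugate of a partition with parts at most N, padded to length N.
conj : ℕ → List ℕ → Monomial
conj N []      = replicate N 0
conj N (a ∷ l) = raise a (conj N l)

length-raise : ∀ a α → length (raise a α) ≡ length α
length-raise zero    α       = refl
length-raise (suc a) []      = refl
length-raise (suc a) (x ∷ α) = cong suc (length-raise a α)

length-conj : ∀ N l → length (conj N l) ≡ N
length-conj N []      = List.length-replicate N
length-conj N (a ∷ l) = trans (length-raise a (conj N l)) (length-conj N l)

-- Expresses that the monomial involves only x₁, ..., xₐ.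
VanishesFrom : ℕ → Monomial → Set
VanishesFrom a α = All (_≡ 0) (drop a α)

raise-vanishes : ∀ {a b} α → b ≤ a → VanishesFrom a α → VanishesFrom a (raise b α)
raise-vanishes         α       z≤n       v = v
raise-vanishes         []      (s≤s b≤a) v = []
raise-vanishes {suc a} (x ∷ α) (s≤s b≤a) v = raise-vanishes {a} α b≤a v

conj-vanishes : ∀ N {a l} → All (_≤ a) l → VanishesFrom a (conj N l)
conj-vanishes N {a} []                  = All.drop⁺ a (All.replicate⁺ N refl)
conj-vanishes N {a} {b ∷ l} (b≤a ∷ l≤a) =
  raise-vanishes {a} (conj N l) b≤a (conj-vanishes N {a} l≤a)

∈-factorizations⁻ : ∀ a α {β γ} → (β , γ) ∈ factorizations (a ∷ α) →
  ∃₂ λ b (β′ : Monomial) → ∃ λ γ′ →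
    b ≤ a × β ≡ b ∷ β′ × γ ≡ a ℕ.∸ b ∷ γ′ × (β′ , γ′) ∈ factorizations α
∈-factorizations⁻ a α h
  with b , (β′ , γ′) , b∈ , f∈ , refl ← ∈-cartesianProductWith⁻
         (λ b (β , γ) → (b ∷ β) , (a ℕ.∸ b ∷ γ)) (upTo (suc a)) (factorizations α) h
  = b , β′ , γ′ , ℕ.≤-pred (∈-upTo⁻ b∈) , refl , refl , f∈

∈-factorizations⁺ : ∀ α {a b β γ} → b ≤ a → (β , γ) ∈ factorizations α →
  (b ∷ β , a ℕ.∸ b ∷ γ) ∈ factorizations (a ∷ α)
∈-factorizations⁺ α b≤a h = ∈-cartesianProductWith⁺ _ (∈-upTo⁺ (s≤s b≤a)) h

factorizations-zero : ∀ {α β γ} → All (_≡ 0) α → (β , γ) ∈ factorizations α →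
                      sum β ≡ 0 × γ ≡ α
factorizations-zero [] (here refl) = refl , refl
factorizations-zero {_ ∷ α} (refl ∷ α≡0) h
  with _ , _ , _ , z≤n , refl , refl , h′ ← ∈-factorizations⁻ 0 α h
  with eq , refl ← factorizations-zero α≡0 h′ = eq , refl

-- A squarefree divisor of a monomial in x₁, …, xₐ has degree at most a, and
-- the only one of degree a is x₁ ⋯ xₐ.
factorizations-raise : ∀ a α {β γ} → VanishesFrom a α → (β , γ) ∈ factorizations (raise a α) →
                       All (_≤ 1) β → a ≤ sum β → sum β ≡ a × γ ≡ α
factorizations-raise zero    α       v h β≤1 a≤β = factorizations-zero v h
factorizations-raise (suc a) []      v (here refl) β≤1 ()
factorizations-raise (suc a) (x ∷ α) v h β≤1 a≤β
  with b , β′ , γ′ , b≤a , refl , refl , h′ ← ∈-factorizations⁻ (suc x) (raise a α) h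
  with b≤1 ∷ β′≤1 ← β≤1
  with eq , refl ← factorizations-raise a α v h′ β′≤1
         (ℕ.≤-pred (ℕ.≤-trans a≤β (ℕ.+-monoˡ-≤ (sum β′) b≤1)))
  with b | b≤1
... | zero  | _       = contradiction (subst (suc a ≤_) eq a≤β) ℕ.1+n≰n
... | suc _ | s≤s z≤n = cong suc eq , refl

factorizations-0 : ∀ α → ∃ λ β → (β , α) ∈ factorizations α × All (_≤ 1) β × sum β ≡ 0
factorizations-0 []      = [] , here refl , [] , refl
factorizations-0 (x ∷ α) =
  let β , h , β≤1 , eq = factorizations-0 α in
  0 ∷ β , ∈-factorizations⁺ α z≤n h , z≤n ∷ β≤1 , eq

-- The divisor is x₁ ⋯ xₐ padded with zeros; the bound on `a` prevents `raise` from truncating it.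
∈-factorizations-raise : ∀ a α → a ≤ length α →
  ∃ λ β → (β , α) ∈ factorizations (raise a α) × All (_≤ 1) β × sum β ≡ a
∈-factorizations-raise zero    α       a≤ = factorizations-0 α
∈-factorizations-raise (suc a) (x ∷ α) (s≤s a≤) =
  let β , h , β≤1 , eq = ∈-factorizations-raise a α a≤ in
  1 ∷ β , ∈-factorizations⁺ (raise a α) (s≤s z≤n) h , s≤s z≤n ∷ β≤1 , cong suc eq

indicator-cases : ∀ {P : Set} (P? : Dec P) → (if does P? then 1ℚ else 0ℚ) ≡ 0ℚ ⊎ P
indicator-cases (yes p) = inj₂ p
indicator-cases (no ¬p) = inj₁ refl

e-cases : ∀ k α → e k α ≡ 0ℚ ⊎ (All (_≤ 1) α × sum α ≡ k)
e-cases k α = indicator-cases (All.all? (ℕ._≤? 1) α ×-dec (sum α ℕ.≟ k))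

e-one : ∀ {k α} → All (_≤ 1) α → sum α ≡ k → e k α ≡ 1ℚ
e-one {k} {α} α≤1 eq = cong (if_then 1ℚ else 0ℚ)
  (dec-true (All.all? (ℕ._≤? 1) α ×-dec (sum α ℕ.≟ k)) (α≤1 , eq))

e-nonNeg : ∀ k α → 0ℚ ℚ.≤ e k α
e-nonNeg k α with e-cases k α
... | inj₁ eq         = ℚ.≤-reflexive (sym eq)
... | inj₂ (α≤1 , eq) = ℚ.≤-trans (ℚ.nonNegative⁻¹ 1ℚ) (ℚ.≤-reflexive (sym (e-one α≤1 eq)))

eProd-nonNeg : ∀ l α → 0ℚ ℚ.≤ eProd l α
eProd-nonNeg []      α = e-nonNeg 0 α
eProd-nonNeg (a ∷ l) α = Σℚ-nonNeg (factorizations α)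
  λ {(β , γ)} _ → *-nonNeg (e-nonNeg a β) (eProd-nonNeg l γ)

sum-replicate-0 : ∀ N → sum (replicate N 0) ≡ 0
sum-replicate-0 zero    = refl
sum-replicate-0 (suc N) = sum-replicate-0 N

-- Picking x₁ ⋯ xₐ from `e a` for every part a yields exactly this monomial. That choice contributes
-- 1, and all other contributions are nonnegative.
eProd-conj-pos : ∀ N {l} → All (_≤ N) l → 1ℚ ℚ.≤ eProd l (conj N l)
eProd-conj-pos N [] =
  ℚ.≤-reflexive (sym (e-one (All.replicate⁺ N z≤n) (sum-replicate-0 N)))
eProd-conj-pos N {a ∷ l} (a≤N ∷ l≤N)
  with β , h , β≤1 , eq ← ∈-factorizations-raise a (conj N l)
         (subst (a ≤_) (sym (length-conj N l)) a≤N)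
  = begin
  1ℚ                            ≤⟨ eProd-conj-pos N l≤N ⟩
  eProd l (conj N l)            ≡⟨ ℚ.*-identityˡ _ ⟨
  1ℚ * eProd l (conj N l)       ≡⟨ cong (_* eProd l (conj N l)) (e-one β≤1 eq) ⟨
  e a β * eProd l (conj N l)    ≤⟨ term≤Σℚ (factorizations (raise a (conj N l)))
                                     (λ {(β , γ)} _ → *-nonNeg (e-nonNeg a β) (eProd-nonNeg l γ)) h ⟩
  eProd (a ∷ l) (conj N (a ∷ l)) ∎
  where open ℚ.≤-Reasoning

-- The monomial involves only x₁, ..., xₐ for the largest part a of `l`. If the first part of `m`
-- exceeds a, its factor has no squarefree divisor to offer; if it equals a, the divisor must be x₁
-- ⋯ xₐ, whose cofactor is the conjugate of the tail, and induction applies.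
eProd-conj-≺ : ∀ N {l m} → AllPairs _≥_ l → l ≺ m → eProd m (conj N l) ≡ 0ℚ
eProd-conj-≺ N {a ∷ l} {b ∷ m} (a≥l ∷ _) (this a<b) =
  Σℚ-zero (factorizations (raise a (conj N l))) zero-term
  where
  zero-term : ∀ {βγ} → βγ ∈ factorizations (raise a (conj N l)) →
              e b (proj₁ βγ) * eProd m (proj₂ βγ) ≡ 0ℚ
  zero-term {β , γ} h with e-cases b β
  ... | inj₁ eq = trans (cong (_* eProd m γ) eq) (ℚ.*-zeroˡ (eProd m γ))
  ... | inj₂ (β≤1 , refl) = contradiction
    (sym (proj₁ (factorizations-raise a (conj N l) (conj-vanishes N {a} a≥l) h β≤1 (ℕ.<⇒≤ a<b))))
    (ℕ.<⇒≢ a<b)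
eProd-conj-≺ N {a ∷ l} {a ∷ m} (a≥l ∷ l↓) (next l≺m) =
  Σℚ-zero (factorizations (raise a (conj N l))) zero-term
  where
  zero-term : ∀ {βγ} → βγ ∈ factorizations (raise a (conj N l)) →
              e a (proj₁ βγ) * eProd m (proj₂ βγ) ≡ 0ℚ
  zero-term {β , γ} h with e-cases a β
  ... | inj₁ eq = trans (cong (_* eProd m γ) eq) (ℚ.*-zeroˡ (eProd m γ))
  ... | inj₂ (β≤1 , eq)
    with _ , refl ← factorizations-raise a (conj N l) (conj-vanishes N {a} a≥l) h β≤1
           (ℕ.≤-reflexive (sym eq))
    = trans (cong (e a β *_) (eProd-conj-≺ N l↓ l≺m)) (ℚ.*-zeroʳ (e a β))

-- Uniqueness of the coefficient of e_(n)

*≡0⇒≡0 : ∀ {p q} → 1ℚ ℚ.≤ q → p * q ≡ 0ℚ → p ≡ 0ℚ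
*≡0⇒≡0 {p} {q} 1≤q pq≡0 = ℚ.≤-antisym
  (ℚ.*-cancelʳ-≤-pos q (ℚ.≤-reflexive pq≡0q))
  (ℚ.*-cancelʳ-≤-pos q (ℚ.≤-reflexive (sym pq≡0q)))
  where
  pq≡0q = trans pq≡0 (sym (ℚ.*-zeroˡ q))
  instance
    q-positive = ℚ.positive (ℚ.<-≤-trans (ℚ.positive⁻¹ 1ℚ) 1≤q)

parts≤sum : ∀ l → All (_≤ sum l) l
parts≤sum []      = []
parts≤sum (a ∷ l) =
  ℕ.m≤m+n a (sum l) ∷ All.map (λ b≤ → ℕ.≤-trans b≤ (ℕ.m≤n+m (sum l) a)) (parts≤sum l)

partition-parts : ∀ {n l} → l ∈ partitions n → All (_≤ n) l
partition-parts {n} {l} l∈ with _ , refl ← All.lookup (partitions-composition n) l∈ = parts≤sum l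

∷ʳ⁻-AllPairs : ∀ {R : A → A → Set} xs {y} → AllPairs R (xs ∷ʳ y) → All (λ x → R x y) xs
∷ʳ⁻-AllPairs []       _        = []
∷ʳ⁻-AllPairs (x ∷ xs) (r ∷ rs) = proj₂ (All.∷ʳ⁻ r) ∷ ∷ʳ⁻-AllPairs xs rs

-- The one-part partition closes the sorted list of partitions, so all others precede it.
partition-cases : ∀ n {l} → l ∈ partitions (suc n) → l ≺ suc n ∷ [] ⊎ l ≡ suc n ∷ []
partition-cases n l∈ with ps , eq ← partitions-last n
  with ∈-++⁻ ps (subst (_ ∈_) eq l∈)
... | inj₁ l∈ps       = inj₁ (All.lookup (∷ʳ⁻-AllPairs ps
                          (subst (AllPairs _≺_) eq (partitions-ordered (suc n)))) l∈ps)
... | inj₂ (here l≡n) = inj₂ l≡n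

-- By eProd-conj-≺ the coefficients of e_μ at the conjugates of the partitions
-- form a triangular matrix, so the c l vanish one after another.
only-last-term : ∀ N ps m (c : List ℕ → ℚ) → AllPairs _≺_ (ps ∷ʳ m) →
  All (AllPairs _≥_) ps → All (All (_≤ N)) ps →
  (∀ {l} → l ∈ ps → Σℚ (ps ∷ʳ m) (λ l′ → c l′ * eProd l′ (conj N l)) ≡ 0ℚ) →
  ∀ α → Σℚ (ps ∷ʳ m) (λ l → c l * eProd l α) ≡ c m * eProd m α
only-last-term N []       m c _ _ _ _ α = ℚ.+-identityʳ _
only-last-term N (l ∷ ps) m c (l≺ ∷ sorted) (l↓ ∷ ps↓) (l≤N ∷ ps≤N) vanish α =
  trans (drop-first α)
    (only-last-term N ps m c sorted ps↓ ps≤N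
      (λ l′∈ → trans (sym (drop-first _)) (vanish (there l′∈))) α)
  where
  open ≡-Reasoning
  rest : Monomial → ℚ
  rest β = Σℚ (ps ∷ʳ m) (λ l′ → c l′ * eProd l′ β)

  rest≡0 : rest (conj N l) ≡ 0ℚ
  rest≡0 = Σℚ-zero (ps ∷ʳ m) λ {l′} l′∈ →
    trans (cong (c l′ *_) (eProd-conj-≺ N l↓ (All.lookup l≺ l′∈))) (ℚ.*-zeroʳ (c l′))

  cl≡0 : c l ≡ 0ℚ
  cl≡0 = *≡0⇒≡0 (eProd-conj-pos N l≤N) (begin
    c l * eProd l (conj N l)                     ≡⟨ ℚ.+-identityʳ _ ⟨
    c l * eProd l (conj N l) + 0ℚ                ≡⟨ cong (c l * eProd l (conj N l) +_) rest≡0 ⟨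
    c l * eProd l (conj N l) + rest (conj N l)   ≡⟨ vanish (here refl) ⟩
    0ℚ                                           ∎)

  drop-first : ∀ β → c l * eProd l β + rest β ≡ rest β
  drop-first β = begin
    c l * eProd l β + rest β  ≡⟨ cong (λ z → z * eProd l β + rest β) cl≡0 ⟩
    0ℚ * eProd l β + rest β   ≡⟨ cong (_+ rest β) (ℚ.*-zeroˡ (eProd l β)) ⟩
    0ℚ + rest β               ≡⟨ ℚ.+-identityˡ (rest β) ⟩
    rest β                    ∎

-- The one-part partition is last, so `only-last-term` removes every other term; N = `suc n` bounds
-- all parts. It is applied both to the complete graph and to the difference of two expansions.
multiple-of-e : ∀ n {F} (E : EExpansion (suc n) F) →
  (∀ {l} → l ∈ partitions (suc n) → l ≺ suc n ∷ [] → F (conj (suc n) l) ≡ 0ℚ) →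
  ∀ α → F α ≡ [e suc n ∷ [] ] E * eProd (suc n ∷ []) α
multiple-of-e n {F} E vanish α with ps , eq ← partitions-last n =
  trans (expands′ α)
    (only-last-term (suc n) ps (suc n ∷ []) (EExpansion.coeff E) sorted
      (All.tabulate (All.lookup (partitions-decreasing (suc n)) ∘ ps⊆))
      (All.tabulate (partition-parts ∘ ps⊆))
      (λ l∈ → trans (sym (expands′ _)) (vanish (ps⊆ l∈) (All.lookup (∷ʳ⁻-AllPairs ps sorted) l∈)))
      α)
  where
  sorted = subst (AllPairs _≺_) eq (partitions-ordered (suc n))
  ps⊆ : ∀ {l} → l ∈ ps → l ∈ partitions (suc n)
  ps⊆ l∈ = subst (_ ∈_) (sym eq) (∈-++⁺ˡ l∈)
  expands′ : ∀ β → F β ≡ Σℚ (ps ∷ʳ (suc n ∷ [])) (λ l → [e l ] E * eProd l β)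
  expands′ β = trans (EExpansion.expands E β) (cong (λ xs → Σℚ xs (λ l → [e l ] E * eProd l β)) eq)

-- The difference of the expansions represents the zero series, hence is a multiple of e_(n) that
-- vanishes at x₁ ⋯ xₙ₊₁, where e_(n) itself is at least 1 (with n standing for `suc n` in the
-- index). This lets different expansions of one series be compared.
[e_n]-unique : ∀ n {F} (E E′ : EExpansion (suc n) F) → [e suc n ∷ [] ] E ≡ [e suc n ∷ [] ] E′
[e_n]-unique n {F} E E′ = x∙y⁻¹≈ε⇒x≈y _ _
  (*≡0⇒≡0 (eProd-conj-pos (suc n) (ℕ.≤-refl ∷ []))
    (trans (sym (multiple-of-e n (E ⊖ᴱ E′) (λ _ _ → ℚ.+-inverseʳ (F _)) (conj (suc n) (suc n ∷ []))))
           (ℚ.+-inverseʳ (F (conj (suc n) (suc n ∷ []))))))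
  where open GroupProperties ℚ.+-0-group

-- Values of chromatic symmetric functions

n/1≥0 : ∀ n → 0ℚ ℚ.≤ ℤ.+ n / 1
n/1≥0 n = ℚ.nonNegative⁻¹ (ℤ.+ n / 1) {{ℚ.normalize-nonNeg n 1}}

X-nonNeg : (G : Graph n) (α : Monomial) → 0ℚ ℚ.≤ X G α
X-nonNeg {n} G α = n/1≥0 (length (filter (λ κ → proper? G κ ×-dec hasContent? α κ)
                                         (colorings n (length α))))

module _ {P : A → Set} (P? : Decidable P) where

  count-none : (xs : Vec A n) → (∀ u → ¬ P (Vec.lookup xs u)) → Vec.count P? xs ≡ 0
  count-none []       ¬P = refl
  count-none (x ∷ xs) ¬P with P? x
  ... | yes p = contradiction p (¬P zero)
  ... | no  _ = count-none xs (¬P ∘ suc)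

  count≤1 : (xs : Vec A n) → (∀ u v → P (Vec.lookup xs u) → P (Vec.lookup xs v) → u ≡ v) →
            Vec.count P? xs ≤ 1
  count≤1 []       unique = z≤n
  count≤1 (x ∷ xs) unique with P? x
  ... | yes p = s≤s (ℕ.≤-reflexive (count-none xs λ u q → Fin.0≢1+n (unique zero (suc u) p q)))
  ... | no  _ = count≤1 xs λ u v p q → Fin.suc-injective (unique (suc u) (suc v) p q)

  count≥1 : (xs : Vec A n) (u : Fin n) → P (Vec.lookup xs u) → 1 ≤ Vec.count P? xs
  count≥1 (x ∷ xs) u       p with P? x
  ... | yes _ = s≤s z≤n
  count≥1 (x ∷ xs) zero    p | no ¬p = contradiction p ¬p
  count≥1 (x ∷ xs) (suc u) p | no _  = count≥1 xs u p

-- Distinct vertices of a complete graph are adjacent, so its proper colorings are injective.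
proper-count≤1 : ∀ {k} (κ : Vec (Fin k) n) → Proper (complete n) κ → ∀ i → Vec.count (i Fin.≟_) κ ≤ 1
proper-count≤1 κ proper i = count≤1 (i Fin.≟_) κ λ u v i≡κu i≡κv →
  decidable-stable (u Fin.≟ v) λ u≢v → proper u v u≢v (trans (sym i≡κu) i≡κv)

-- The first color would have to occur at least twice in an injective coloring. Testing the first
-- exponent suffices for conjugates, where it is the largest.
X-complete-nonsquarefree : ∀ n a α → X (complete n) (suc (suc a) ∷ α) ≡ 0ℚ
X-complete-nonsquarefree n a α = cong (λ κs → ℤ.+ length κs / 1)
  (List.filter-none (λ κ → proper? (complete n) κ ×-dec hasContent? (suc (suc a) ∷ α) κ)
    (All.universal
      (λ κ (proper , content) →
        ℕ.1+n≰n (ℕ.≤-trans (s≤s (s≤s z≤n))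
          (subst (_≤ 1) (content zero) (proper-count≤1 κ proper zero))))
      (colorings n _)))

∈-colorings : ∀ {k} (κ : Vec (Fin k) n) → κ ∈ colorings n k
∈-colorings []      = here refl
∈-colorings (i ∷ κ) = ∈-cartesianProductWith⁺ _∷_ (∈-allFin i) (∈-colorings κ)

length/1≢0 : {x : A} {xs : List A} → x ∈ xs → ℤ.+ length xs / 1 ≢ 0ℚ
length/1≢0 {xs = _ ∷ xs} _ = ≢-sym (ℚ.<⇒≢
  (ℚ.positive⁻¹ (ℤ.+ suc (length xs) / 1) {{ℚ.normalize-pos (suc (length xs)) 1}}))

-- Coloring each vertex by its own index is proper and uses every color once. The equation for `n`
-- identifies vertices with colors.
X-complete-squarefree : ∀ {n} α → n ≡ length α → All (_≡ 1) α → X (complete n) α ≢ 0ℚ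
X-complete-squarefree α refl α≡1 = length/1≢0
  (∈-filter⁺ (λ κ → proper? (complete _) κ ×-dec hasContent? α κ) (∈-colorings κ) (proper , content))
  where
  κ = Vec.allFin (length α)
  proper : Proper (complete (length α)) κ
  proper u v u≢v eq = u≢v
    (trans (sym (Vec.lookup-allFin u)) (trans eq (Vec.lookup-allFin v)))
  content : HasContent α κ
  content i = trans
    (ℕ.≤-antisym (proper-count≤1 κ proper i) (count≥1 (i Fin.≟_) κ i (sym (Vec.lookup-allFin i))))
    (sym (All.lookup α≡1 (∈-lookup i)))

raise-replicate : ∀ n → All (_≡ 1) (raise n (replicate n 0))
raise-replicate zero    = []
raise-replicate (suc n) = refl ∷ raise-replicate n

raise-raise : ∀ a b α → 1 ≤ length α →
  ∃₂ λ x β → raise (suc a) (raise (suc b) α) ≡ suc (suc x) ∷ β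
raise-raise a b (x ∷ α) _ = x , _ , refl

-- The first exponent of the conjugate is the number of parts, and a single part would have to equal
-- the sum `suc n`.
conj-nonsquarefree : ∀ n {l} → IsComposition (suc n) l → l ≺ suc n ∷ [] →
                     ∃₂ λ x β → conj (suc n) l ≡ suc (suc x) ∷ β
conj-nonsquarefree n {_ ∷ []} (_ , eq) (this a<n) =
  contradiction (trans (sym (ℕ.+-identityʳ _)) eq) (ℕ.<⇒≢ a<n)
conj-nonsquarefree n {suc a ∷ suc b ∷ m} _ _ =
  raise-raise a b (conj (suc n) m) (subst (1 ≤_) (sym (length-conj (suc n) m)) (s≤s z≤n))
conj-nonsquarefree n {zero ∷ _ ∷ _}      (() ∷ _ , _)
conj-nonsquarefree n {suc _ ∷ zero ∷ _}  (_ ∷ () ∷ _ , _)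

X-complete-conj : ∀ n {l} → l ∈ partitions (suc n) → l ≺ suc n ∷ [] →
                  X (complete (suc n)) (conj (suc n) l) ≡ 0ℚ
X-complete-conj n l∈ l≺n =
  let x , β , eq = conj-nonsquarefree n (All.lookup (partitions-composition (suc n)) l∈) l≺n in
  trans (cong (X (complete (suc n))) eq) (X-complete-nonsquarefree (suc n) x β)

-- Reversing a comparison, and minimality of the complete graph

module _ n {F G : Series} (EF : EExpansion (suc n) F) (EG : EExpansion (suc n) G)
  {{_ : NonZero ([e suc n ∷ [] ] EF)}} {{_ : NonZero ([e suc n ∷ [] ] EG)}}
  (F-vanishes : ∀ {l} → l ∈ partitions (suc n) → l ≺ suc n ∷ [] → F (conj (suc n) l) ≡ 0ℚ)
  (G≥0 : ∀ α → 0ℚ ℚ.≤ G α)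
  (positive : EPositive (suc n) (F ⊖ ([e suc n ∷ [] ] EF ÷ [e suc n ∷ [] ] EG) · G))
  where

  private
    [n] : List ℕ
    [n] = suc n ∷ []

    k c : ℚ
    k = [e [n] ] EF
    c = [e [n] ] EG

    P   = proj₁ positive
    P≥0 = proj₂ positive

    -- The scalars of the two comparisons: `r` multiplies G when it is subtracted from F, and `q`
    -- multiplies F when it is subtracted from G.
    q r : ℚ
    q = c ÷ k
    r = k ÷ c

    qr≡1 : q * r ≡ 1ℚ
    qr≡1 = begin
      (c * 1/ k) * (k * 1/ c)  ≡⟨ solve 4 (λ c c⁻ k k⁻ → (c :* k⁻) :* (k :* c⁻) := (c :* c⁻) :* (k :* k⁻))
                                    refl c (1/ c) k (1/ k) ⟩
      (c * 1/ c) * (k * 1/ k)  ≡⟨ cong₂ _*_ (ℚ.*-inverseʳ c) (ℚ.*-inverseʳ k) ⟩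
      1ℚ                       ∎
      where
      open ≡-Reasoning
      open +-*-Solver

    scale : ∀ x y → q * (x - r * y) ≡ q * x - y
    scale x y = begin
      q * (x - r * y)      ≡⟨ solve 4 (λ q r x y → q :* (x :- r :* y) := q :* x :- (q :* r) :* y)
                                refl q r x y ⟩
      q * x - (q * r) * y  ≡⟨ cong (λ z → q * x - z * y) qr≡1 ⟩
      q * x - 1ℚ * y       ≡⟨ cong (λ z → q * x - z) (ℚ.*-identityˡ y) ⟩
      q * x - y            ∎
      where
      open ≡-Reasoning
      open +-*-Solver

    -- Since q r = 1, scaling the expansion `P` by -q gives an expansion of the reversed difference.
    neg-scale : ∀ x y → - q * (x - r * y) ≡ y - q * x
    neg-scale x y = begin
      - q * (x - r * y)    ≡⟨ ℚ.neg-distribˡ-* q (x - r * y) ⟨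
      - (q * (x - r * y))  ≡⟨ cong -_ (scale x y) ⟩
      - (q * x - y)        ≡⟨ solve 2 (λ a b → :- (a :- b) := b :- a) refl (q * x) y ⟩
      y - q * x            ∎
      where
      open ≡-Reasoning
      open +-*-Solver

    -- The scalar `r` is chosen to cancel this coefficient in the difference of `EF` and `r ·ᴱ EG`;
    -- uniqueness carries this over to the given `P`.
    [e_n]P≡0 : [e [n] ] P ≡ 0ℚ
    [e_n]P≡0 = begin
      [e [n] ] P          ≡⟨ [e_n]-unique n P (EF ⊖ᴱ r ·ᴱ EG) ⟩
      k - (k * 1/ c) * c  ≡⟨ cong (λ z → k - z) (ℚ.*-assoc k (1/ c) c) ⟩
      k - k * (1/ c * c)  ≡⟨ cong (λ z → k - k * z) (ℚ.*-inverseˡ c) ⟩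
      k - k * 1ℚ          ≡⟨ cong (λ z → k - z) (ℚ.*-identityʳ k) ⟩
      k - k               ≡⟨ ℚ.+-inverseʳ k ⟩
      0ℚ                  ∎
      where open ≡-Reasoning

    -- At the conjugate of `l` the series F vanishes, so q P takes the value -G ≤ 0 there. This
    -- value is also a sum of nonnegative terms, one of which is at least the coefficient in
    -- question.
    q[e_l]P≤0 : 0ℚ ℚ.≤ q → ∀ {l} → l ∈ partitions (suc n) → l ≺ [n] → q * [e l ] P ℚ.≤ 0ℚ
    q[e_l]P≤0 q≥0 {l} l∈ l≺n = begin
      q * [e l ] P                   ≡⟨ ℚ.*-identityʳ _ ⟨
      q * [e l ] P * 1ℚ              ≤⟨ ℚ.*-monoˡ-≤-nonNeg (q * [e l ] P) {{ℚ.nonNegative (qP≥0 l∈)}}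
                                          (eProd-conj-pos (suc n) (partition-parts l∈)) ⟩
      q * [e l ] P * eProd l α       ≤⟨ term≤Σℚ (partitions (suc n))
                                          (λ {l′} l′∈ → *-nonNeg (qP≥0 l′∈) (eProd-nonNeg l′ α)) l∈ ⟩
      Σℚ (partitions (suc n)) (λ l′ → q * [e l′ ] P * eProd l′ α)
                                     ≡⟨ EExpansion.expands (q ·ᴱ P) α ⟨
      q * (F α - r * G α)            ≡⟨ scale (F α) (G α) ⟩
      q * F α - G α                  ≡⟨ cong (λ z → q * z - G α) (F-vanishes l∈ l≺n) ⟩
      q * 0ℚ - G α                   ≡⟨ cong (_- G α) (ℚ.*-zeroʳ q) ⟩
      0ℚ - G α                       ≤⟨ ℚ.+-monoʳ-≤ 0ℚ (ℚ.neg-antimono-≤ (G≥0 α)) ⟩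
      0ℚ                             ∎
      where
      open ℚ.≤-Reasoning
      α = conj (suc n) l
      qP≥0 : ∀ {l′} → l′ ∈ partitions (suc n) → 0ℚ ℚ.≤ q * [e l′ ] P
      qP≥0 l′∈ = *-nonNeg q≥0 (P≥0 l′∈)

    -- Only nonvanishing of `k` and `c` is given, so `q` may have either sign. For q ≤ 0 both
    -- factors are nonnegative; for q ≥ 0 the product is bounded below by `q[e_l]P≤0`, or is zero at
    -- the one-part partition.
    nonNeg : ∀ {l} → l ∈ partitions (suc n) → 0ℚ ℚ.≤ - q * [e l ] P
    nonNeg {l} l∈ = [ q≥0-case , q≤0-case ]′ (ℚ.≤-total 0ℚ q)
      where
      q≤0-case : q ℚ.≤ 0ℚ → 0ℚ ℚ.≤ - q * [e l ] P
      q≤0-case q≤0 = *-nonNeg (ℚ.neg-antimono-≤ q≤0) (P≥0 l∈)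

      q≥0-case : 0ℚ ℚ.≤ q → 0ℚ ℚ.≤ - q * [e l ] P
      q≥0-case q≥0 =
        [ (λ l≺n → subst (0ℚ ℚ.≤_) (ℚ.neg-distribˡ-* q ([e l ] P))
                     (ℚ.neg-antimono-≤ (q[e_l]P≤0 q≥0 l∈ l≺n)))
        , (λ l≡n → ℚ.≤-reflexive (sym
            (trans (cong (- q *_) (trans (cong (λ m → [e m ] P) l≡n) [e_n]P≡0)) (ℚ.*-zeroʳ (- q)))))
        ]′ (partition-cases n l∈)

  EPositive-reverse : EPositive (suc n) (G ⊖ ([e suc n ∷ [] ] EG ÷ [e suc n ∷ [] ] EF) · F)
  EPositive-reverse =
    EExpansion-resp-≐ (λ α → neg-scale (F α) (G α)) (- q ·ᴱ P) , λ {l} → nonNeg {l}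

-- Otherwise the series would vanish identically, contradicting its value at x₁ ⋯ xₙ₊₁. The relation
-- K ≥ H provides nonvanishing only for H, while the reversed one divides by this coefficient.
[e_n]X-complete-nonZero : ∀ n (E : EExpansion (suc n) (X (complete (suc n)))) →
                          NonZero ([e suc n ∷ [] ] E)
[e_n]X-complete-nonZero n E = ℚ.≢-nonZero {[e suc n ∷ [] ] E} λ k≡0 →
  X-complete-squarefree α (sym (length-conj (suc n) (suc n ∷ []))) (raise-replicate (suc n))
    (trans (multiple-of-e n E (X-complete-conj n) α)
    (trans (cong (_* eProd (suc n ∷ []) α) k≡0) (ℚ.*-zeroˡ (eProd (suc n ∷ []) α))))
  where α = conj (suc n) (suc n ∷ [])

K-minimal : ∀ n (H : ConnectedGraph (suc n)) → K (suc n) ≥ₑ H → H ≥ₑ K (suc n)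
K-minimal n H K≥H = record
  { expansionˡ = expansionʳ
  ; expansionʳ = expansionˡ
  ; nonZero    = k-nonZero
  ; ePositive  = EPositive-reverse n expansionˡ expansionʳ {{k-nonZero}} {{nonZero}}
      (X-complete-conj n) (X-nonNeg (ConnectedGraph.graph H)) ePositive
  }
  where
  open _≥ₑ_ K≥H
  k-nonZero = [e_n]X-complete-nonZero n expansionˡ

corollary3p5 : (n : ℕ) → 1 ≤ n → IsMinimal (𝓔 n) (K n)
corollary3p5 (suc n) 1≤n H (inj₁ H≥K) = H≥K
corollary3p5 (suc n) 1≤n H (inj₂ K≥H) = K-minimal n H K≥H
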